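{- Every tree of diameter $5$ is odd-graceful.
   Context: A graph $G$ with $n$ edges is odd-graceful if there is an injective map $f:V(G)\to\{0,1,2,\dots,2n-1\}$ such that the set of induced edge weights $\{|f(x)-f(y)| : xy\in E(G)\}$ equals $\{1,3,5,\dots,2n-1\}$. -}

module Defs where

open import Data.Fin.Base using (Fin; toℕ)
open import Data.Fin.Properties using (_<?_)
open import Data.List.Base using (List; []; _∷_; allFin; cartesianProduct; filter; length)
open import Data.List.Relation.Unary.Unique.Propositional using (Unique)
open import Data.Nat.Base as ℕ using (ℕ; suc; _+_; _*_; _≤_; ∣_-_∣; NonZero)
open import Data.Product.Base using (_×_; _,_; ∃-syntax)
open import Function.Definitions using (Injective)
open import Level using (0ℓ)
open import Relation.Binary.Construct.Closure.ReflexiveTransitive using (Star; ε; _◅_)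
open import Relation.Binary.Core using (Rel)
open import Relation.Binary.Definitions using (Decidable; Irreflexive; Symmetric)
open import Relation.Binary.PropositionalEquality.Core using (_≡_)
open import Relation.Nullary.Decidable.Core using (_×-dec_)
open import Relation.Nullary.Negation.Core using (¬_)
open import Relation.Unary using (Pred; _≐_)

record Graph (v : ℕ) : Set₁ where
  infix 4 _~_ _~?_
  field
    _~_      : Rel (Fin v) 0ℓ
    _~?_     : Decidable _~_
    ~-sym    : Symmetric _~_
    ~-irrefl : Irreflexive _≡_ _~_

-- {1, 3, …, 2n − 1}
firstOdds : ℕ → Pred ℕ 0ℓ
firstOdds n w = ∃[ k ] k ℕ.< n × w ≡ 1 + 2 * k

module _ {v : ℕ} (G : Graph v) where
  open Graph G

  -- Each edge xy is listed once, as the pair with x < y.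
  edges : List (Fin v × Fin v)
  edges = filter (λ (x , y) → (x <? y) ×-dec (x ~? y))
                 (cartesianProduct (allFin v) (allFin v))

  size : ℕ
  size = length edges

  Walk : Rel (Fin v) 0ℓ
  Walk = Star _~_

  walkLength : ∀ {x y} → Walk x y → ℕ
  walkLength ε       = 0
  walkLength (_ ◅ p) = suc (walkLength p)

  -- The vertices of a walk except its final one; on a closed walk the base
  -- point is therefore counted once.
  sources : ∀ {x y} → Walk x y → List (Fin v)
  sources ε               = []
  sources {x = x} (_ ◅ p) = x ∷ sources p

  IsCycle : ∀ {x} → Walk x x → Set
  IsCycle p = 3 ≤ walkLength p × Unique (sources p)

  record IsTree : Set where
    field
      nonEmpty  : NonZero v
      connected : ∀ x y → Walk x y
      acyclic   : ∀ {x} (p : Walk x x) → ¬ IsCycle p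

  IsDistance : Fin v → Fin v → ℕ → Set
  IsDistance x y d =
    (∃[ p ] walkLength {x} {y} p ≡ d) × (∀ (p : Walk x y) → d ≤ walkLength p)

  -- The maximum of all distances, required to be finite.
  IsDiameter : ℕ → Set
  IsDiameter D =
    (∀ x y → ∃[ d ] IsDistance x y d × d ≤ D) × (∃[ x ] ∃[ y ] IsDistance x y D)

  edgeWeights : (Fin v → ℕ) → Pred ℕ 0ℓ
  edgeWeights f w = ∃[ x ] ∃[ y ] x ~ y × w ≡ ∣ f x - f y ∣

  -- Fin (2 * size) is the label set {0, 1, …, 2n − 1}.
  OddGraceful : Set
  OddGraceful = ∃[ f ] Injective {A = Fin v} {B = Fin (2 * size)} _≡_ _≡_ f
                     × edgeWeights (λ x → toℕ (f x)) ≐ firstOdds size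

{-# OPTIONS --safe #-}
module Submission where

-- Let ab be the central edge and root the tree at a: every vertex has depth at
-- most 3, and those of depth 3 are grandchildren of b.  With n edges, number the
-- vertices 0, …, n by depth, putting b last at depth 1 and arranging the vertices of
-- depth 2 and of depth 3 in the reverse order of their parents.  Give a the label 0,
-- and choose the other labels, alternately above and below the parent's label, so
-- that the edge from x up to its parent has weight 1 + 2 (n − pos x).  Labels are then
-- even at even depth and odd at odd depth, and within each parity they are monotone
-- in pos: the reversal of the parents makes the differences pos x − pos (parent x)
-- increase, and b being last separates depth 1 from depth 3.

open import Defs
open import Data.Empty using (⊥-elim)
open import Data.Fin.Base as Fin
  using (Fin; toℕ; fromℕ; fromℕ<; inject₁; combine; opposite; punchIn; punchOut)
open import Data.Fin.Properties
  using (any?; toℕ<n; toℕ-fromℕ<; toℕ-injective; fromℕ<-injective; fromℕ<-cong; fromℕ≢inject₁;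
         inject₁-injective; ≤fromℕ; combine-monoˡ-<; combine-injectiveʳ; toℕ-combine; opposite-prop;
         punchInᵢ≢i; punchIn-injective; punchIn-punchOut; punchOut-injective; <⇒notInjective)
  renaming (_<?_ to _<ᶠ?_; _≟_ to _≟ᶠ_; <-asym to <ᶠ-asym)
open import Data.Fin.Subset using (Subset; inside; ∣_∣) renaming (_∈_ to _∈ˢ_)
open import Data.Fin.Subset.Properties using (p⊂q⇒∣p∣<∣q∣; ∣⊤∣≡n; ∈⊤)
open import Data.List.Base using (List; []; _∷_; _++_; map; allFin; cartesianProduct; length)
open import Data.List.Properties using (length-map; length-tabulate)
open import Data.List.Membership.Propositional using (_∈_)
open import Data.List.Membership.Propositional.Properties
  using (∈-map⁺; ∈-map⁻; ∈-filter⁺; ∈-filter⁻; ∈-cartesianProduct⁺; ∈-allFin)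
open import Data.List.Membership.Propositional.Properties.WithK using (unique∧set⇒bag)
open import Data.List.Relation.Binary.BagAndSetEquality using (∼bag⇒↭)
open import Data.List.Relation.Binary.Permutation.Propositional.Properties using (↭-length)
open import Data.List.Relation.Unary.All as All using (All; []; _∷_)
open import Data.List.Relation.Unary.All.Properties using () renaming (++⁺ to All-++⁺)
open import Data.List.Relation.Unary.AllPairs using ([]; _∷_)
open import Data.List.Relation.Unary.AllPairs.Properties using () renaming (++⁺ to AllPairs-++⁺)
open import Data.List.Relation.Unary.Unique.Propositional using (Unique)
import Data.List.Relation.Unary.Unique.Propositional.Properties as Unique
open import Data.Nat.Base
open import Data.Nat.Properties
open import Data.Product.Base using (_×_; _,_; ∃-syntax; proj₁; proj₂)
open import Data.Sum.Base using (_⊎_; inj₁; inj₂)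
open import Data.Vec.Base using (tabulate)
open import Data.Vec.Properties using (lookup∘tabulate; []=⇒lookup; lookup⇒[]=)
open import Function.Base using (_∘_)
open import Function.Bundles using (mk⇔)
open import Function.Definitions using (Injective)
open import Relation.Binary.Construct.Closure.ReflexiveTransitive using (ε; _◅_; _◅◅_)
open import Relation.Binary.Definitions using (tri<; tri≈; tri>)
open import Relation.Binary.PropositionalEquality
open import Relation.Nullary.Decidable using (Dec; yes; no; does; dec-true; _×-dec_)
open import Relation.Nullary.Negation.Core using (¬_; contradiction)

-- Distances in a tree

module Walks {v} (G : Graph v) where
  open Graph G

  walkLength-◅◅ : ∀ {x y z} (p : Walk G x y) (q : Walk G y z) →
                  walkLength G (p ◅◅ q) ≡ walkLength G p + walkLength G q
  walkLength-◅◅ ε       q = refl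
  walkLength-◅◅ (_ ◅ p) q = cong suc (walkLength-◅◅ p q)

  sources-◅◅ : ∀ {x y z} (p : Walk G x y) (q : Walk G y z) →
               sources G (p ◅◅ q) ≡ sources G p ++ sources G q
  sources-◅◅ ε       q = refl
  sources-◅◅ (_ ◅ p) q = cong (_ ∷_) (sources-◅◅ p q)

  reversal : ∀ {x y} (p : Walk G x y) → ∃[ q ] walkLength G {y} {x} q ≡ walkLength G p
  reversal ε = ε , refl
  reversal (e ◅ p) with q , ∣q∣ ← reversal p =
    q ◅◅ (~-sym e ◅ ε) ,
    trans (walkLength-◅◅ q _) (trans (+-comm _ 1) (cong suc ∣q∣))

  vertices : ∀ {x y} → Walk G x y → List (Fin v)
  vertices {y = y} p = sources G p ++ y ∷ []

module TreeDistance {v} (G : Graph v)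
    (acyclic : ∀ {x} (p : Walk G x x) → ¬ IsCycle G p)
    (dist : ∀ x y → ∃[ d ] IsDistance G x y d) where
  open Graph G
  open Walks G

  -- The distance to r: the tree is rooted at the first argument, which makes
  -- δ r the depth function.
  δ : Fin v → Fin v → ℕ
  δ r x = proj₁ (dist x r)

  geodesic : ∀ r x → ∃[ p ] walkLength G {x} {r} p ≡ δ r x
  geodesic r x = proj₁ (proj₂ (dist x r))

  δ≤walkLength : ∀ {r x} (p : Walk G x r) → δ r x ≤ walkLength G p
  δ≤walkLength {r} {x} = proj₂ (proj₂ (dist x r))

  -- Needed because the pair realising the diameter comes with its own distance witness, separate
  -- from the one that `δ` picks.
  δ-unique : ∀ {r x d} → IsDistance G x r d → δ r x ≡ d
  δ-unique {r} {x} ((p , ∣p∣) , min) = ≤-antisym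
    (subst (δ r x ≤_) ∣p∣ (δ≤walkLength p))
    (subst (_ ≤_) (proj₂ (geodesic r x)) (min _))

  δ-refl : ∀ r → δ r r ≡ 0
  δ-refl r = n≤0⇒n≡0 (δ≤walkLength ε)

  δ≡0⇒≡ : ∀ {r x} → δ r x ≡ 0 → x ≡ r
  δ≡0⇒≡ {r} {x} eq with geodesic r x
  ... | ε     , _   = refl
  ... | _ ◅ _ , ∣p∣ = contradiction (trans ∣p∣ eq) λ ()

  δ-triangle : ∀ x y z → δ z x ≤ δ y x + δ z y
  δ-triangle x y z with p , ∣p∣ ← geodesic y x | q , ∣q∣ ← geodesic z y =
    subst (δ z x ≤_) (trans (walkLength-◅◅ p q) (cong₂ _+_ ∣p∣ ∣q∣)) (δ≤walkLength (p ◅◅ q))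

  δ-sym-≤ : ∀ x y → δ x y ≤ δ y x
  δ-sym-≤ x y with p , ∣p∣ ← geodesic y x with q , ∣q∣ ← reversal p =
    subst (δ x y ≤_) (trans ∣q∣ ∣p∣) (δ≤walkLength q)

  δ-sym : ∀ x y → δ x y ≡ δ y x
  δ-sym x y = ≤-antisym (δ-sym-≤ x y) (δ-sym-≤ y x)

  δ-step : ∀ r {x y} → x ~ y → δ r x ≤ suc (δ r y)
  δ-step r {x} {y} e with p , ∣p∣ ← geodesic r y =
    subst (δ r x ≤_) (cong suc ∣p∣) (δ≤walkLength (e ◅ p))

  lower : ∀ {r x k} → δ r x ≡ suc k → ∃[ y ] x ~ y × δ r y ≡ k
  lower {r} {x} eq with geodesic r x
  ... | ε , ∣p∣ = contradiction (trans ∣p∣ eq) λ ()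
  ... | _◅_ {j = y} e p , ∣p∣ = y , e ,
    ≤-antisym
      (subst (δ r y ≤_) (suc-injective (trans ∣p∣ eq)) (δ≤walkLength p))
      (s≤s⁻¹ (subst (_≤ suc (δ r y)) eq (δ-step r e)))

  1≤walkLength : ∀ {x y} (p : Walk G x y) → x ≢ y → 1 ≤ walkLength G p
  1≤walkLength ε       x≢y = contradiction refl x≢y
  1≤walkLength (_ ◅ p) _   = s≤s z≤n

  below⇒fresh : ∀ {r k w zs} → All (λ z → suc k ≤ δ r z) zs → δ r w ≡ k → All (w ≢_) zs
  below⇒fresh above w₀ = All.map (λ { k<w refl → <-irrefl (sym w₀) k<w }) above

  -- Extend the path by the lower neighbours of both of its ends: they close it
  -- to a cycle when they coincide, and otherwise give such a path one level down.
  no-upper-path : ∀ r k {x y} (p : Walk G x y) → x ≢ y → δ r x ≡ k → δ r y ≡ k →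
                  Unique (vertices p) → ¬ All (λ z → k ≤ δ r z) (vertices p)
  no-upper-path r zero p x≢y x₀ y₀ _ _ = x≢y (trans (δ≡0⇒≡ x₀) (sym (δ≡0⇒≡ y₀)))
  no-upper-path r (suc k) {x} {y} p x≢y x₁ y₁ uniq above
    with x′ , x~x′ , x′₀ ← lower x₁ | y′ , y~y′ , y′₀ ← lower y₁ | x′ ≟ᶠ y′
  ... | yes refl = acyclic q (long , subst Unique (sym q-sources) (below⇒fresh above x′₀ ∷ uniq))
    where
    q = ~-sym x~x′ ◅ (p ◅◅ (y~y′ ◅ ε))
    q-sources : sources G q ≡ x′ ∷ vertices p
    q-sources = cong (x′ ∷_) (sources-◅◅ p _)
    long : 3 ≤ walkLength G q
    long = s≤s (subst (2 ≤_) (sym (trans (walkLength-◅◅ p _) (+-comm _ 1)))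
                  (s≤s (1≤walkLength p x≢y)))
  ... | no x′≢y′ = no-upper-path r k q x′≢y′ x′₀ y′₀
        (subst Unique (sym q-vertices)
          (All-++⁺ (below⇒fresh above x′₀) (x′≢y′ ∷ []) ∷
           AllPairs-++⁺ uniq ([] ∷ [])
             (All.map (λ w≢z → (λ z≡w → w≢z (sym z≡w)) ∷ []) (below⇒fresh above y′₀))))
        (subst (All _) (sym q-vertices)
          (≤-reflexive (sym x′₀) ∷
           All-++⁺ (All.map (≤-trans (n≤1+n k)) above) (≤-reflexive (sym y′₀) ∷ [])))
    where
    q = ~-sym x~x′ ◅ (p ◅◅ (y~y′ ◅ ε))
    q-vertices : vertices q ≡ x′ ∷ vertices p ++ y′ ∷ []
    q-vertices = cong (λ zs → x′ ∷ zs ++ y′ ∷ []) (sources-◅◅ p _)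

  -- An edge inside one level would be a one-edge path of the kind that `no-upper-path` forbids.
  δ-edge-≢ : ∀ r {x y} → x ~ y → δ r x ≢ δ r y
  δ-edge-≢ r {x} {y} e eq = no-upper-path r _ (e ◅ ε) x≢y refl (sym eq)
    ((x≢y ∷ []) ∷ [] ∷ []) (≤-refl ∷ ≤-reflexive eq ∷ [])
    where
    x≢y : x ≢ y
    x≢y x≡y = ~-irrefl x≡y e

  δ-edge : ∀ r {x y} → x ~ y → δ r x ≡ suc (δ r y) ⊎ δ r y ≡ suc (δ r x)
  δ-edge r {x} {y} e with <-cmp (δ r x) (δ r y)
  ... | tri< x<y _ _ = inj₂ (≤-antisym (δ-step r (~-sym e)) x<y)
  ... | tri≈ _ x≡y _ = contradiction x≡y (δ-edge-≢ r e)
  ... | tri> _ _ y<x = inj₁ (≤-antisym (δ-step r e) y<x)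

  -- Distinct lower neighbours `y` and `z` would be joined through `x` by a path that
  -- `no-upper-path` forbids.
  lower-unique : ∀ r {x y z} → x ~ y → x ~ z →
                 δ r x ≡ suc (δ r y) → δ r x ≡ suc (δ r z) → y ≡ z
  lower-unique r {x} {y} {z} x~y x~z eq₁ eq₂ with y ≟ᶠ z
  ... | yes y≡z = y≡z
  ... | no  y≢z = contradiction
        (≤-refl ∷ <⇒≤ (≤-reflexive (sym eq₁)) ∷ ≤-reflexive (suc-injective (trans (sym eq₁) eq₂)) ∷ [])
        (no-upper-path r _ (~-sym x~y ◅ x~z ◅ ε) y≢z refl (suc-injective (trans (sym eq₂) eq₁))
          (((λ y≡x → ~-irrefl (sym y≡x) x~y) ∷ y≢z ∷ []) ∷
           ((λ x≡z → ~-irrefl x≡z x~z) ∷ []) ∷ [] ∷ []))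

  module _ {a b} (a~b : a ~ b) where

    δ-across : ∀ z → δ b z ≤ suc (δ a z)
    δ-across z = subst (δ b z ≤_) (+-comm _ 1) (≤-trans (δ-triangle z a b)
      (+-monoʳ-≤ (δ a z) (subst (δ b a ≤_) (cong suc (δ-refl b)) (δ-step b a~b))))

    -- `δ-edge` is applied with the tree rooted at `z`, and symmetry turns the distances around.
    -- Every vertex thus lies on one side of `ab`.
    δ-compare : ∀ z → δ b z ≡ suc (δ a z) ⊎ δ a z ≡ suc (δ b z)
    δ-compare z with δ-edge z a~b
    ... | inj₁ eq = inj₂ (trans (δ-sym a z) (trans eq (cong suc (δ-sym z b))))
    ... | inj₂ eq = inj₁ (trans (δ-sym b z) (trans eq (cong suc (δ-sym z a))))

    -- Crossing `ab` gives the upper bound, the step from `z` the lower one: walking from `z`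
    -- towards `a` stays on the side of `a`.
    lower-farther : ∀ {k z w} → z ~ w → δ a w ≡ k → δ b z ≡ suc (suc k) → δ b w ≡ suc k
    lower-farther {w = w} z~w refl z₂ = ≤-antisym (δ-across w)
      (s≤s⁻¹ (subst (_≤ suc (δ b w)) z₂ (δ-step b z~w)))

    -- The path from z to r runs through a and then b; its next vertex u is carried along
    -- so that the induction can see that this path does not turn back.
    δ-through : ∀ {r} → δ r a ≡ suc (δ r b) → ∀ k {z} → δ a z ≡ k → δ b z ≡ suc k →
                δ r z ≡ k + δ r a × ∃[ u ] z ~ u × δ r z ≡ suc (δ r u) × δ b u ≤ k
    δ-through {r} a₁ zero z₀ _ with refl ← δ≡0⇒≡ z₀ =
      refl , b , a~b , a₁ , ≤-reflexive (δ-refl b)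
    δ-through {r} a₁ (suc k) {z} z₁ z₂
      with w , z~w , w₀ ← lower z₁
      with w₁ ← lower-farther z~w w₀ z₂
      with w-dist , u , w~u , u-dist , u≤k ← δ-through a₁ k w₀ w₁ | δ-edge r z~w
    ... | inj₁ z-dist = trans z-dist (cong suc w-dist) , w , z~w , z-dist , ≤-reflexive w₁
    -- Here `u` and `z` would both be the lower neighbour of `w`, but `u` is closer to `b` than `z`
    -- is.
    ... | inj₂ w-dist′ with refl ← lower-unique r w~u (~-sym z~w) u-dist w-dist′ =
      contradiction (subst (_≤ k) z₂ u≤k) (<⇒≱ (m<n⇒m<1+n (n<1+n k)))

-- Rooted trees

-- This interface hides walks and distances from the edge count and the labelling. The use of `pred`
-- lets `depth-parent` cover the root, which is its own parent.
record Rooting {v} (G : Graph v) (a : Fin v) : Set where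
  open Graph G
  field
    depth        : Fin v → ℕ
    parent       : Fin v → Fin v
    depth≡0⇒root : ∀ {x} → depth x ≡ 0 → x ≡ a
    depth-parent : ∀ x → depth (parent x) ≡ pred (depth x)
    parent-edge  : ∀ {x} → x ≢ a → x ~ parent x
    edge-parent  : ∀ {x y} → x ~ y → y ≡ parent x × x ≢ a ⊎ x ≡ parent y × y ≢ a

module _ {n} {G : Graph (suc n)} {a : Fin (suc n)} (R : Rooting G a) where
  open Graph G
  open Rooting R

  depth-child : ∀ {x} → x ≢ a → depth x ≡ suc (depth (parent x))
  depth-child {x} x≢a = trans
    (sym (suc-pred (depth x) ⦃ ≢-nonZero (λ x₀ → x≢a (depth≡0⇒root x₀)) ⦄))
    (cong suc (sym (depth-parent x)))

  private
    -- The smaller end comes first, as in `edges`, so that the two enumerations have literally the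
    -- same members.
    edgeAbove : Fin (suc n) → Fin (suc n) × Fin (suc n)
    edgeAbove x with x <ᶠ? parent x
    ... | yes _ = x , parent x
    ... | no  _ = parent x , x

    edgeAbove-injective : ∀ {x y} → x ≢ a → y ≢ a → edgeAbove x ≡ edgeAbove y → x ≡ y
    edgeAbove-injective {x} {y} x≢a y≢a eq with x <ᶠ? parent x | y <ᶠ? parent y
    ... | yes _ | yes _ = cong proj₁ eq
    ... | no  _ | no  _ = cong proj₂ eq
    -- Opposite orientations make `x` and `y` parents of each other, so a depth would exceed itself
    -- by two.
    ... | yes _ | no  _ = contradiction
      (trans (depth-child x≢a) (cong suc (trans (cong depth (cong proj₂ eq))
        (trans (depth-child y≢a) (cong suc (cong depth (sym (cong proj₁ eq))))))))
      (<⇒≢ (m<n⇒m<1+n (n<1+n _)))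
    ... | no  _ | yes _ = contradiction
      (trans (depth-child x≢a) (cong suc (trans (cong depth (cong proj₁ eq))
        (trans (depth-child y≢a) (cong suc (cong depth (sym (cong proj₂ eq))))))))
      (<⇒≢ (m<n⇒m<1+n (n<1+n _)))

    edge? = λ ((x , y) : Fin (suc n) × Fin (suc n)) → (x <ᶠ? y) ×-dec (x ~? y)

    edgeAbove∈edges : ∀ {x} → x ≢ a → edgeAbove x ∈ edges G
    edgeAbove∈edges {x} x≢a with x <ᶠ? parent x
    ... | yes x<p = ∈-filter⁺ edge? (∈-cartesianProduct⁺ (∈-allFin _) (∈-allFin _))
                      (x<p , parent-edge x≢a)
    ... | no  x≮p = ∈-filter⁺ edge? (∈-cartesianProduct⁺ (∈-allFin _) (∈-allFin _))
                      (≤∧≢⇒< (≮⇒≥ x≮p) (λ eq → ~-irrefl (sym (toℕ-injective eq)) (parent-edge x≢a)) ,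
                       ~-sym (parent-edge x≢a))

    edges⇒edgeAbove : ∀ {e} → e ∈ edges G → ∃[ x ] x ≢ a × e ≡ edgeAbove x
    edges⇒edgeAbove {x , y} e∈
      with proj₂ (∈-filter⁻ edge? {xs = cartesianProduct (allFin (suc n)) (allFin (suc n))} e∈)
    ... | x<y , x~y with edge-parent x~y
    edges⇒edgeAbove {x , y} e∈ | x<y , x~y | inj₁ (refl , x≢a) = x , x≢a , eq
      where
      eq : (x , parent x) ≡ edgeAbove x
      eq with x <ᶠ? parent x
      ... | yes _   = refl
      ... | no  x≮p = contradiction x<y x≮p
    edges⇒edgeAbove {x , y} e∈ | x<y , x~y | inj₂ (refl , y≢a) = y , y≢a , eq
      where
      eq : (parent y , y) ≡ edgeAbove y
      eq with y <ᶠ? parent y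
      ... | yes y<p = contradiction x<y (<ᶠ-asym y<p)
      ... | no  _   = refl

  -- `punchIn a` runs over the non-root vertices, each matched with the edge to its parent. Two
  -- duplicate-free lists with the same members are permutations of each other.
  size≡ : size G ≡ n
  size≡ = begin
    length (edges G)           ≡⟨ ↭-length (∼bag⇒↭ (unique∧set⇒bag edges! above! (mk⇔ to from))) ⟩
    length (map f (allFin n))  ≡⟨ length-map f (allFin n) ⟩
    length (allFin n)          ≡⟨ length-tabulate _ ⟩
    n                          ∎
    where
    open ≡-Reasoning
    f : Fin n → Fin (suc n) × Fin (suc n)
    f i = edgeAbove (punchIn a i)
    edges! = Unique.filter⁺ edge?
      (Unique.cartesianProduct⁺ (Unique.allFin⁺ (suc n)) (Unique.allFin⁺ (suc n)))
    above! = Unique.map⁺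
      (λ eq → punchIn-injective a _ _ (edgeAbove-injective (punchInᵢ≢i a _) (punchInᵢ≢i a _) eq))
      (Unique.allFin⁺ n)
    to : ∀ {e} → e ∈ edges G → e ∈ map f (allFin n)
    to e∈ with x , x≢a , refl ← edges⇒edgeAbove e∈ =
      subst (λ y → edgeAbove y ∈ map f (allFin n)) (punchIn-punchOut (λ a≡x → x≢a (sym a≡x)))
        (∈-map⁺ f (∈-allFin _))
    from : ∀ {e} → e ∈ map f (allFin n) → e ∈ edges G
    from e∈ with i , _ , refl ← ∈-map⁻ f e∈ = edgeAbove∈edges (punchInᵢ≢i a i)

-- Numbering by a key

-- Pigeonhole: a missed value could be punched out of the codomain, leaving an injection into a
-- smaller set.
injective⇒surjective : ∀ {n} {f : Fin n → Fin n} → Injective _≡_ _≡_ f → ∀ i → ∃[ x ] f x ≡ i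
injective⇒surjective {suc n} {f} inj i with any? (λ x → f x ≟ᶠ i)
... | yes hit  = hit
... | no  miss = ⊥-elim (<⇒notInjective {f = λ x → punchOut (avoids x)} (n<1+n n)
  (λ eq → inj (punchOut-injective (avoids _) (avoids _) eq)))
  where
  avoids : ∀ x → i ≢ f x
  avoids x i≡fx = miss (x , sym i≡fx)

module Rank {m} (key : Fin m → ℕ) (key-injective : Injective _≡_ _≡_ key) where

  abstract
    below : Fin m → Subset m
    below x = tabulate (λ y → does (key y <? key x))

    ∈-below⁺ : ∀ {x y} → key y < key x → y ∈ˢ below x
    ∈-below⁺ {x} {y} y<x = lookup⇒[]= y _
      (trans (lookup∘tabulate _ y) (dec-true (key y <? key x) y<x))

    ∈-below⁻ : ∀ {x y} → y ∈ˢ below x → key y < key x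
    ∈-below⁻ {x} {y} y∈ = witness (key y <? key x) (trans (sym (lookup∘tabulate _ y)) ([]=⇒lookup y∈))
      where
      witness : ∀ {P : Set} (P? : Dec P) → does P? ≡ inside → P
      witness (yes p) _ = p

    -- Counting smaller keys sorts without building a list; as keys are distinct, this is a
    -- bijection onto the numbers below `m`.
    pos : Fin m → ℕ
    pos x = ∣ below x ∣

    pos<m : ∀ x → pos x < m
    pos<m x = subst (pos x <_) (∣⊤∣≡n m)
      (p⊂q⇒∣p∣<∣q∣ ((λ _ → ∈⊤) , x , ∈⊤ , λ x∈ → <-irrefl refl (∈-below⁻ x∈)))

    pos-mono-< : ∀ {x y} → key x < key y → pos x < pos y
    pos-mono-< {x} x<y = p⊂q⇒∣p∣<∣q∣
      ((λ z∈ → ∈-below⁺ (<-trans (∈-below⁻ z∈) x<y)) , x , ∈-below⁺ x<y ,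
       λ x∈ → <-irrefl refl (∈-below⁻ x∈))

    pos-mono-≤ : ∀ {x y} → key x ≤ key y → pos x ≤ pos y
    pos-mono-≤ {x} {y} x≤y with m≤n⇒m<n∨m≡n x≤y
    ... | inj₁ x<y = <⇒≤ (pos-mono-< x<y)
    ... | inj₂ x≡y = ≤-reflexive (cong pos (key-injective x≡y))

    pos-cancel-< : ∀ {x y} → pos x < pos y → key x < key y
    pos-cancel-< {x} {y} p with key x <? key y
    ... | yes x<y = x<y
    ... | no  x≮y = contradiction p (≤⇒≯ (pos-mono-≤ (≮⇒≥ x≮y)))

    pos-injective : Injective _≡_ _≡_ pos
    pos-injective {x} {y} eq with <-cmp (key x) (key y)
    ... | tri< x<y _ _ = contradiction eq (<⇒≢ (pos-mono-< x<y))
    ... | tri≈ _ x≡y _ = key-injective x≡y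
    ... | tri> _ _ y<x = contradiction (sym eq) (<⇒≢ (pos-mono-< y<x))

    pos-surjective : ∀ {i} → i < m → ∃[ x ] pos x ≡ i
    pos-surjective i<m with x , eq ← injective⇒surjective {f = λ x → fromℕ< (pos<m x)}
                                       (λ eq → pos-injective (fromℕ<-injective _ _ _ _ eq)) (fromℕ< i<m) =
      x , fromℕ<-injective _ _ (pos<m x) i<m eq

module _ {k m o : ℕ} where
  abstract
    -- A mixed-radix number, which encodes the lexicographic order on triples.
    lex : Fin k → Fin m → Fin o → ℕ
    lex i j l = toℕ (combine (combine i j) l)

    lex-<₁ : ∀ {i i′} j j′ l l′ → i Fin.< i′ → lex i j l < lex i′ j′ l′
    lex-<₁ {i} {i′} j j′ l l′ i<i′ =
      combine-monoˡ-< {i = combine i j} {combine i′ j′} l l′ (combine-monoˡ-< j j′ i<i′)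

    lex-<₂ : ∀ i {j j′} l l′ → j Fin.< j′ → lex i j l < lex i j′ l′
    lex-<₂ i {j} {j′} l l′ j<j′ = combine-monoˡ-< {i = combine i j} {combine i j′} l l′
      (subst₂ _<_ (sym (toℕ-combine i j)) (sym (toℕ-combine i j′)) (+-monoʳ-< (m * toℕ i) j<j′))

    lex-≤₃ : ∀ i j {l l′} → l Fin.≤ l′ → lex i j l ≤ lex i j l′
    lex-≤₃ i j {l} {l′} l≤l′ =
      subst₂ _≤_ (sym (toℕ-combine (combine i j) l)) (sym (toℕ-combine (combine i j) l′))
        (+-monoʳ-≤ (o * toℕ (combine i j)) l≤l′)

    lex-injective₃ : ∀ i i′ j j′ {l l′} → lex i j l ≡ lex i′ j′ l′ → l ≡ l′
    lex-injective₃ i i′ j j′ {l} {l′} eq =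
      combine-injectiveʳ (combine i j) l (combine i′ j′) l′ (toℕ-injective eq)

opposite-anti-< : ∀ {n} {i j : Fin n} → i Fin.< j → opposite j Fin.< opposite i
opposite-anti-< {n} {i} {j} i<j rewrite opposite-prop i | opposite-prop j =
  ∸-monoʳ-< (s≤s i<j) (toℕ<n j)

module _ {n} (b : Fin n) where

  -- A tie-breaker: `b` moves to a new top value and all other vertices keep their order.
  raise : Fin n → Fin (suc n)
  raise x with x ≟ᶠ b
  ... | yes _ = fromℕ n
  ... | no  _ = inject₁ x

  raise-injective : Injective _≡_ _≡_ raise
  raise-injective {x} {y} eq with x ≟ᶠ b | y ≟ᶠ b
  ... | yes refl | yes refl = refl
  ... | yes _    | no  _    = contradiction eq fromℕ≢inject₁
  ... | no  _    | yes _    = contradiction (sym eq) fromℕ≢inject₁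
  ... | no  _    | no  _    = inject₁-injective eq

  raise-max : ∀ x → raise x Fin.≤ raise b
  raise-max x with b ≟ᶠ b
  ... | yes _  = ≤fromℕ (raise x)
  ... | no b≢b = contradiction refl b≢b

-- Arithmetic of labels and weights

∸-telescope : ∀ {k m l} → k ≤ m → m ≤ l → (l ∸ m) + (m ∸ k) ≡ l ∸ k
∸-telescope {k} {m} {l} k≤m m≤l = trans (sym (+-∸-assoc (l ∸ m) k≤m)) (cong (_∸ k) (m∸n+n≡m m≤l))

odd<even : ∀ {k m} → k < m → 1 + 2 * k < 2 * m
odd<even {k} {m} k<m = subst (_≤ 2 * m) (*-suc 2 k) (*-monoʳ-≤ 2 k<m)

-- Along an edge of weight `1 + 2 * k` below depth 1, this writes the larger, odd label as the
-- smaller, even one plus the weight.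
odd-split : ∀ k m → 1 + 2 * (k + m) ≡ 2 * m + (1 + 2 * k)
odd-split k m = trans (cong suc (trans (*-distribˡ-+ 2 k m) (+-comm (2 * k) (2 * m))))
                      (sym (+-suc (2 * m) (2 * k)))

-- The labelling

module Labelling {n} {G : Graph (suc n)} {a : Fin (suc n)} (R : Rooting G a)
    (b : Fin (suc n)) (depth-b : Rooting.depth R b ≡ 1)
    (depth≤3 : ∀ x → Rooting.depth R x ≤ 3)
    (grandparent-b : ∀ {x} → Rooting.depth R x ≡ 3 → Rooting.parent R (Rooting.parent R x) ≡ b)
    where
  open Graph G
  open Rooting R

  V : Set
  V = Fin (suc n)

  σ : V → Fin (2+ n)
  σ = raise b

  level : V → Fin 4
  level x = fromℕ< (s≤s (depth≤3 x))

  -- Parents are compared by `σ` because `pos` is only defined from `key`. Where the comparison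
  -- matters the parents are siblings, and there both orders agree.
  rparent : V → Fin (2+ n)
  rparent x = opposite (σ (parent x))

  key : V → ℕ
  key x = lex (level x) (rparent x) (σ x)

  key-injective : Injective _≡_ _≡_ key
  key-injective {x} {y} eq =
    raise-injective b (lex-injective₃ (level x) (level y) (rparent x) (rparent y) eq)

  open Rank key key-injective

  level-cong : ∀ {x y} → depth x ≡ depth y → level x ≡ level y
  level-cong eq = fromℕ<-cong _ _ eq _ _

  shallower⇒pos< : ∀ {x y} → depth x < depth y → pos x < pos y
  shallower⇒pos< {x} {y} x<y = pos-mono-< (lex-<₁ (rparent x) (rparent y) (σ x) (σ y)
      (subst₂ _<_ (sym (toℕ-fromℕ< _)) (sym (toℕ-fromℕ< _)) x<y))

  pos<⇒depth≤ : ∀ {x y} → pos x < pos y → depth x ≤ depth y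
  pos<⇒depth≤ p = ≮⇒≥ (λ d → <-asym p (shallower⇒pos< d))

  -- Siblings agree in the first two components of `key`, so `σ` alone orders them.
  siblings-pos≤ : ∀ {x y} → depth x ≡ depth y → parent x ≡ parent y → σ x Fin.≤ σ y → pos x ≤ pos y
  siblings-pos≤ {x} {y} d p x≤y = pos-mono-≤ (subst (_≤ key y)
    (cong₂ (λ i j → lex i j (σ x)) (level-cong (sym d)) (cong (opposite ∘ σ) (sym p)))
    (lex-≤₃ (level y) (rparent y) x≤y))

  pos<⇒parents-reversed : ∀ {x y} → depth x ≡ depth y → pos x < pos y → σ (parent y) Fin.≤ σ (parent x)
  pos<⇒parents-reversed {x} {y} d p = ≮⇒≥ λ q → <-asym (pos-cancel-< p)
    (subst (λ l → lex (level y) (rparent y) (σ y) < lex l (rparent x) (σ x)) (level-cong (sym d))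
      (lex-<₂ (level y) (σ y) (σ x) (opposite-anti-< q)))

  parent-pos< : ∀ {x k} → depth x ≡ suc k → pos (parent x) < pos x
  parent-pos< {x} x₁ = shallower⇒pos<
    (≤-reflexive (trans (cong suc (trans (depth-parent x) (cong pred x₁))) (sym x₁)))

  -- The order of `x` and `y` reverses their parents in `σ`; the common grandparent makes these
  -- siblings, which carries the reversal over to `pos`. The gap between a vertex and its parent
  -- therefore grows with the position.
  parents-pos≥ : ∀ {x y k} → depth x ≡ k → depth y ≡ k → parent (parent x) ≡ parent (parent y) →
                 pos x < pos y → pos (parent y) ≤ pos (parent x)
  parents-pos≥ {x} {y} x₁ y₁ g p = siblings-pos≤
    (trans (depth-parent y) (trans (cong pred d) (sym (depth-parent x))))
    (sym g) (pos<⇒parents-reversed (sym d) p)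
    where d = trans y₁ (sym x₁)

  depth-pos>0 : ∀ {x k} → depth x ≡ suc k → 0 < pos x
  depth-pos>0 x₁ = <-≤-trans (s≤s z≤n) (parent-pos< x₁)

  grandparent-a : ∀ {x} → depth x ≡ 2 → parent (parent x) ≡ a
  grandparent-a {x} x₂ = depth≡0⇒root
    (trans (depth-parent (parent x)) (cong pred (trans (depth-parent x) (cong pred x₂))))

  pos≤pos-b : ∀ {x} → depth x ≡ 1 → pos x ≤ pos b
  pos≤pos-b {x} x₁ = siblings-pos≤ (trans x₁ (sym depth-b))
    (trans (depth≡0⇒root (trans (depth-parent x) (cong pred x₁)))
           (sym (depth≡0⇒root (trans (depth-parent b) (cong pred depth-b)))))
    (raise-max b x)

  pos≤n : ∀ x → pos x ≤ n
  pos≤n x = s≤s⁻¹ (pos<m x)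

  -- The last clause serves depth 3: it adds the weight to the parent's label, with `pos b` standing
  -- for the position of the grandparent.
  labelAt : ℕ → V → ℕ
  labelAt 0 x = 0
  labelAt 1 x = 1 + 2 * (n ∸ pos x)
  labelAt 2 x = 2 * (pos x ∸ pos (parent x))
  labelAt _ x = 1 + 2 * (n ∸ pos x + (pos (parent x) ∸ pos b))

  label : V → ℕ
  label x = labelAt (depth x) x

  b-before-parent : ∀ {x} → depth x ≡ 3 → pos b < pos (parent x)
  b-before-parent {x} x₃ = subst (λ y → pos y < pos (parent x)) (grandparent-b x₃)
    (parent-pos< (trans (depth-parent x) (cong pred x₃)))

  -- The difference `n ∸ pos b` telescopes through `pos x`, and `parent x` precedes `x`. Labels at
  -- depth 3 are thus below that of `b`, the least one at depth 1.
  deep-gap : ∀ {x} → depth x ≡ 3 → n ∸ pos x + (pos (parent x) ∸ pos b) < n ∸ pos b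
  deep-gap {x} x₃ = <-≤-trans
    (+-monoʳ-< (n ∸ pos x) (∸-monoˡ-< (parent-pos< x₃) (<⇒≤ (b-before-parent x₃))))
    (≤-reflexive (∸-telescope (<⇒≤ (<-trans (b-before-parent x₃) (parent-pos< x₃))) (pos≤n x)))

  label-bound : ∀ x → label x < 2 * n
  label-bound x with depth x in eq | depth≤3 x
  -- The label 0 is in range because `b` has a position from 1 to `n`, so `n` is positive.
  ... | 0 | _ = *-monoʳ-< 2 (<-≤-trans (depth-pos>0 depth-b) (pos≤n b))
  ... | 1 | _ = odd<even (∸-monoʳ-< (depth-pos>0 eq) (pos≤n x))
  -- Strictness comes from the parent, which has depth 1 and so is not in position 0.
  ... | 2 | _ = *-monoʳ-< 2 (<-≤-trans
    (∸-monoʳ-< (depth-pos>0 (trans (depth-parent x) (cong pred eq))) (<⇒≤ (parent-pos< eq)))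
    (pos≤n x))
  ... | 3 | _ = odd<even (<-≤-trans (deep-gap eq) (m∸n≤m n (pos b)))
  ... | suc (suc (suc (suc _))) | s≤s (s≤s (s≤s ()))

  -- As `x` comes first, its depth is at most that of `y`. Even labels (depths 0 and 2) increase
  -- with the position, odd ones (depths 1 and 3) decrease, and the parities never meet.
  labelAt-distinct : ∀ {x y} i j → depth x ≡ i → depth y ≡ j → j ≤ 3 → pos x < pos y →
                     labelAt i x ≢ labelAt j y
  labelAt-distinct {x} {y} i j xᵢ yⱼ j≤3 x<y = go i j xᵢ yⱼ (subst₂ _≤_ xᵢ yⱼ (pos<⇒depth≤ x<y)) j≤3
    where
    even< : ∀ {k m} → k < m → 2 * k ≢ 2 * m
    even< k<m = <⇒≢ (*-monoʳ-< 2 k<m)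
    odd> : ∀ {k m} → m < k → 1 + 2 * k ≢ 1 + 2 * m
    odd> m<k = >⇒≢ (s≤s (*-monoʳ-< 2 m<k))
    go : ∀ i j → depth x ≡ i → depth y ≡ j → i ≤ j → j ≤ 3 → labelAt i x ≢ labelAt j y
    go 0 0 x₀ y₀ _ _ _ = <-irrefl (cong pos (trans (depth≡0⇒root x₀) (sym (depth≡0⇒root y₀)))) x<y
    go 0 2 _ y₂ _ _ = even< (m<n⇒0<n∸m (parent-pos< y₂))
    go 1 1 _ _ _ _ = odd> (∸-monoʳ-< x<y (pos≤n y))
    -- The label of `b` separates the two: it is above that of `y` and at most that of `x`.
    go 1 3 x₁ y₃ _ _ = odd> (<-≤-trans (deep-gap y₃) (∸-monoʳ-≤ n (pos≤pos-b x₁)))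
    go 2 2 x₂ y₂ _ _ = even< (≤-<-trans (∸-monoʳ-≤ (pos x) p)
      (∸-monoˡ-< x<y (≤-trans p (<⇒≤ (parent-pos< x₂)))))
      where p = parents-pos≥ x₂ y₂ (trans (grandparent-a x₂) (sym (grandparent-a y₂))) x<y
    -- The first summand drops strictly and the second does not rise.
    go 3 3 x₃ y₃ _ _ = odd> (+-mono-<-≤ (∸-monoʳ-< x<y (pos≤n y))
      (∸-monoˡ-≤ (pos b) (parents-pos≥ x₃ y₃ (trans (grandparent-b x₃) (sym (grandparent-b y₃))) x<y)))
    go 0 1 _ _ _ _ = even≢odd 0 (n ∸ pos y)
    go 0 3 _ _ _ _ = even≢odd 0 (n ∸ pos y + (pos (parent y) ∸ pos b))
    go 1 2 _ _ _ _ = even≢odd (pos y ∸ pos (parent y)) (n ∸ pos x) ∘ sym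
    go 2 3 _ _ _ _ = even≢odd (pos x ∸ pos (parent x)) (n ∸ pos y + (pos (parent y) ∸ pos b))
    go 1 0 _ _ ()
    go (suc (suc _)) 0 _ _ ()
    go (suc (suc _)) 1 _ _ (s≤s ())
    go (suc (suc (suc _))) 2 _ _ (s≤s (s≤s ()))
    go (suc (suc (suc (suc _)))) 3 _ _ (s≤s (s≤s (s≤s ())))
    go _ (suc (suc (suc (suc _)))) _ _ _ (s≤s (s≤s (s≤s ())))

  label-injective : Injective _≡_ _≡_ label
  label-injective {x} {y} eq with <-cmp (pos x) (pos y)
  ... | tri< x<y _ _ = contradiction eq (labelAt-distinct _ _ refl refl (depth≤3 y) x<y)
  ... | tri≈ _ x≡y _ = pos-injective x≡y
  ... | tri> _ _ y<x = contradiction (sym eq) (labelAt-distinct _ _ refl refl (depth≤3 x) y<x)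

  weight : ∀ {x} → x ≢ a → ∣ label x - label (parent x) ∣ ≡ 1 + 2 * (n ∸ pos x)
  weight {x} x≢a = trans
    (cong (λ d → ∣ label x - labelAt d (parent x) ∣) (depth-parent x))
    (go (depth x) refl (depth≤3 x))
    where
    go : ∀ d → depth x ≡ d → d ≤ 3 →
         ∣ labelAt d x - labelAt (pred d) (parent x) ∣ ≡ 1 + 2 * (n ∸ pos x)
    go 0 x₀ _ = contradiction (depth≡0⇒root x₀) x≢a
    go 1 _ _  = refl
    -- At depth 2 the parent has the larger label.
    go 2 x₂ _ = trans
      (cong (λ m → ∣ 2 * (pos x ∸ pos (parent x)) - m ∣)
        (trans (cong (λ m → 1 + 2 * m) (sym (∸-telescope (<⇒≤ (parent-pos< x₂)) (pos≤n x))))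
               (odd-split (n ∸ pos x) (pos x ∸ pos (parent x)))))
      (∣m-m+n∣≡n (2 * (pos x ∸ pos (parent x))) _)
    -- At depth 3 the larger label is that of `x`; the rewriting puts `pos b` for the position of
    -- the grandparent in the parent's label.
    go 3 x₃ _ rewrite grandparent-b x₃ = trans
      (∣-∣-comm (labelAt 3 x) (2 * (pos (parent x) ∸ pos b)))
      (trans (cong (λ m → ∣ 2 * (pos (parent x) ∸ pos b) - m ∣)
               (odd-split (n ∸ pos x) (pos (parent x) ∸ pos b)))
             (∣m-m+n∣≡n (2 * (pos (parent x) ∸ pos b)) _))
    go (suc (suc (suc (suc _)))) _ (s≤s (s≤s (s≤s ())))

  -- Some vertex occupies position 0, and no vertex of positive depth does.
  pos-root : pos a ≡ 0
  pos-root with x , x₀ ← pos-surjective {0} (s≤s z≤n) with depth x in eq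
  ... | 0     = trans (cong pos (sym (depth≡0⇒root eq))) x₀
  ... | suc _ = contradiction x₀ (>⇒≢ (depth-pos>0 eq))

  oddGraceful : OddGraceful G
  oddGraceful = f , f-injective , from , to
    where
    bound : ∀ x → label x < 2 * size G
    bound x = subst (label x <_) (cong (2 *_) (sym (size≡ R))) (label-bound x)
    f : V → Fin (2 * size G)
    f x = fromℕ< (bound x)
    f-injective : Injective _≡_ _≡_ f
    f-injective eq = label-injective (fromℕ<-injective _ _ _ _ eq)
    weight-f : ∀ x y → ∣ toℕ (f x) - toℕ (f y) ∣ ≡ ∣ label x - label y ∣
    weight-f x y = cong₂ ∣_-_∣ (toℕ-fromℕ< (bound x)) (toℕ-fromℕ< (bound y))
    odd : ∀ {x w} → x ≢ a → w ≡ ∣ label x - label (parent x) ∣ → firstOdds (size G) w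
    odd {x} x≢a eq = n ∸ pos x ,
      subst (n ∸ pos x <_) (sym (size≡ R)) (∸-monoʳ-< (depth-pos>0 (depth-child R x≢a)) (pos≤n x)) ,
      trans eq (weight x≢a)
    from : ∀ {w} → edgeWeights G (toℕ ∘ f) w → firstOdds (size G) w
    from (x , y , x~y , eq) with edge-parent x~y
    ... | inj₁ (refl , x≢a) = odd x≢a (trans eq (weight-f x y))
    ... | inj₂ (refl , y≢a) = odd y≢a (trans eq (trans (weight-f x y) (∣-∣-comm (label x) (label y))))
    to : ∀ {w} → firstOdds (size G) w → edgeWeights G (toℕ ∘ f) w
    -- The weight `1 + 2 * k` belongs to the edge above the vertex in position `n ∸ k`. This
    -- position is positive, so the vertex is not the root.
    to (k , k<size , refl) with k<n ← subst (k <_) (size≡ R) k<size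
      with x , eq ← pos-surjective (s≤s (m∸n≤m n k)) =
      x , parent x , parent-edge x≢a ,
      sym (trans (weight-f x (parent x)) (trans (weight x≢a)
        (cong (λ m → 1 + 2 * m) (trans (cong (n ∸_) eq) (m∸[m∸n]≡n (<⇒≤ k<n))))))
      where
      x≢a : x ≢ a
      x≢a refl = <⇒≢ (m<n⇒0<n∸m k<n) (trans (sym pos-root) eq)

-- The central edge

module _ {v} (G : Graph v)
    (acyclic : ∀ {x} (p : Walk G x x) → ¬ IsCycle G p)
    (dist : ∀ x y → ∃[ d ] IsDistance G x y d) where
  open Graph G
  open TreeDistance G acyclic dist

  module _ (a : Fin v) where

    -- The root is its own lower neighbour.
    descend : ∀ x → ∃[ y ] δ a y ≡ pred (δ a x) × (∀ {k} → δ a x ≡ suc k → x ~ y)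
    descend x with δ a x in eq
    ... | zero  = x , eq , λ ()
    ... | suc _ with y , x~y , y₀ ← lower eq = y , y₀ , λ _ → x~y

    lowerNeighbour : Fin v → Fin v
    lowerNeighbour x = proj₁ (descend x)

    lowerNeighbour-δ : ∀ x → δ a (lowerNeighbour x) ≡ pred (δ a x)
    lowerNeighbour-δ x = proj₁ (proj₂ (descend x))

    lowerNeighbour-~ : ∀ {x k} → δ a x ≡ suc k → x ~ lowerNeighbour x
    lowerNeighbour-~ {x} = proj₂ (proj₂ (descend x))

    lowerNeighbour-unique : ∀ {x y} → x ~ y → δ a x ≡ suc (δ a y) → y ≡ lowerNeighbour x
    lowerNeighbour-unique {x} x~y eq = lower-unique a x~y (lowerNeighbour-~ eq) eq
      (trans eq (cong suc (sym (trans (lowerNeighbour-δ x) (cong pred eq)))))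

    rooting : Rooting G a
    rooting = record
      { depth        = δ a
      ; parent       = lowerNeighbour
      ; depth≡0⇒root = δ≡0⇒≡
      ; depth-parent = lowerNeighbour-δ
      ; parent-edge  = parent-edge
      ; edge-parent  = edge-parent
      }
      where
      parent-edge : ∀ {x} → x ≢ a → x ~ lowerNeighbour x
      parent-edge x≢a = lowerNeighbour-~
        (sym (suc-pred _ ⦃ ≢-nonZero (λ x₀ → x≢a (δ≡0⇒≡ x₀)) ⦄))
      nonRoot : ∀ {x k} → δ a x ≡ suc k → x ≢ a
      nonRoot x₁ refl = contradiction (trans (sym (δ-refl a)) x₁) λ ()
      edge-parent : ∀ {x y} → x ~ y →
                    y ≡ lowerNeighbour x × x ≢ a ⊎ x ≡ lowerNeighbour y × y ≢ a
      edge-parent x~y with δ-edge a x~y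
      ... | inj₁ eq = inj₁ (lowerNeighbour-unique x~y eq , nonRoot eq)
      ... | inj₂ eq = inj₂ (lowerNeighbour-unique (~-sym x~y) eq , nonRoot eq)

  -- By `lower-farther` with the ends of `ab` exchanged, the neighbour of `x` closer to `b` is also
  -- closer to `a`; uniqueness identifies it.
  lowerNeighbour-toward : ∀ {a b} → a ~ b → ∀ {k x} → δ b x ≡ suc k → δ a x ≡ suc (suc k) →
    δ b (lowerNeighbour a x) ≡ k × δ a (lowerNeighbour a x) ≡ suc k
  lowerNeighbour-toward {a} a~b x₁ x₂
    with y , x~y , y₀ ← lower x₁
    with y₁ ← lower-farther (~-sym a~b) x~y y₀ x₂
    with refl ← lowerNeighbour-unique a x~y (trans x₂ (cong suc (sym y₁))) = y₀ , y₁

  -- `ab` is the middle edge of a longest path `s, s′, a, b, …, r`. A vertex on the side of `a`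
  -- reaches `r` through `a`, with 3 steps still to go, so it is within 2 of `a`; likewise for `b`
  -- and `s`.
  centralEdge : (∀ x y → δ x y ≤ 5) → ∀ {r s} → δ r s ≡ 5 →
    ∃[ a ] ∃[ b ] a ~ b × ∀ z → δ b z ≡ suc (δ a z) × δ a z ≤ 2 ⊎ δ a z ≡ suc (δ b z) × δ b z ≤ 2
  centralEdge δ≤5 {r} {s} s₅
    with s′ , s~s′ , s′₄ ← lower s₅
    with a , s′~a , a₃ ← lower s′₄
    with b , a~b , b₂ ← lower a₃ = a , b , a~b , side
    where
    -- Only 2 of the 5 steps from `s` to `r` remain after `b`.
    3≤b : 3 ≤ δ s b
    3≤b = +-cancelʳ-≤ 2 3 (δ s b) (begin
      5               ≡⟨ s₅ ⟨
      δ r s           ≤⟨ δ-triangle s b r ⟩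
      δ b s + δ r b   ≡⟨ cong₂ _+_ (δ-sym b s) b₂ ⟩
      δ s b + 2       ∎)
      where open ≤-Reasoning
    a≤2 : δ s a ≤ 2
    a≤2 = ≤-trans (δ-step s (~-sym s′~a)) (s≤s
      (≤-trans (δ-step s (~-sym s~s′)) (s≤s (≤-reflexive (δ-refl s)))))
    b-after-a : δ s b ≡ suc (δ s a)
    b-after-a with δ-edge s a~b
    ... | inj₁ eq = contradiction (≤-trans (s≤s 3≤b) (subst (_≤ 2) eq a≤2)) λ { (s≤s (s≤s ())) }
    ... | inj₂ eq = eq
    side : ∀ z → δ b z ≡ suc (δ a z) × δ a z ≤ 2 ⊎ δ a z ≡ suc (δ b z) × δ b z ≤ 2
    side z with δ-compare a~b z
    ... | inj₁ eq = inj₁ (eq , +-cancelʳ-≤ 3 (δ a z) 2 (begin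
          δ a z + 3       ≡⟨ cong (δ a z +_) a₃ ⟨
          δ a z + δ r a   ≡⟨ proj₁ (δ-through a~b (trans a₃ (cong suc (sym b₂))) (δ a z) refl eq) ⟨
          δ r z           ≤⟨ δ≤5 r z ⟩
          5               ∎))
      where open ≤-Reasoning
    ... | inj₂ eq = inj₂ (eq , +-cancelʳ-≤ 3 (δ b z) 2 (begin
          δ b z + 3       ≤⟨ +-monoʳ-≤ (δ b z) 3≤b ⟩
          δ b z + δ s b   ≡⟨ proj₁ (δ-through (~-sym a~b) b-after-a (δ b z) refl eq) ⟨
          δ s z           ≤⟨ δ≤5 s z ⟩
          5               ∎))
      where open ≤-Reasoning

-- From the central edge to the labelling

module _ {n} (G : Graph (suc n))
    (acyclic : ∀ {x} (p : Walk G x x) → ¬ IsCycle G p)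
    (dist : ∀ x y → ∃[ d ] IsDistance G x y d) where
  open Graph G
  open TreeDistance G acyclic dist

  centralEdge⇒oddGraceful : ∀ {a b} → a ~ b →
    (∀ z → δ b z ≡ suc (δ a z) × δ a z ≤ 2 ⊎ δ a z ≡ suc (δ b z) × δ b z ≤ 2) → OddGraceful G
  centralEdge⇒oddGraceful {a} {b} a~b side =
    Labelling.oddGraceful (rooting G acyclic dist a) b depth-b depth≤3 grandparent-b
    where
    π : Fin (suc n) → Fin (suc n)
    π = lowerNeighbour G acyclic dist a
    depth-b : δ a b ≡ 1
    depth-b with side b
    ... | inj₁ (eq , _) = contradiction (trans (sym (δ-refl b)) eq) λ ()
    ... | inj₂ (eq , _) = trans eq (cong suc (δ-refl b))
    depth≤3 : ∀ x → δ a x ≤ 3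
    depth≤3 x with side x
    ... | inj₁ (_  , a≤2) = ≤-trans a≤2 (n≤1+n 2)
    ... | inj₂ (eq , b≤2) = ≤-trans (≤-reflexive eq) (s≤s b≤2)
    -- Depth 3 excludes the side of `a`, so `x` is at distance 2 from `b` and both parent steps lead
    -- towards `b`.
    grandparent-b : ∀ {x} → δ a x ≡ 3 → π (π x) ≡ b
    grandparent-b {x} x₃ with side x
    ... | inj₁ (_  , a≤2) = contradiction (subst (_≤ 2) x₃ a≤2) λ { (s≤s (s≤s ())) }
    ... | inj₂ (eq , _)
      with p₁ , p₂ ← lowerNeighbour-toward G acyclic dist a~b (suc-injective (trans (sym eq) x₃)) x₃ =
      δ≡0⇒≡ (proj₁ (lowerNeighbour-toward G acyclic dist a~b p₁ p₂))

theorem4 : ∀ {v : ℕ} (G : Graph v) → IsTree G → IsDiameter G 5 → OddGraceful G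
theorem4 {zero} G T (_ , () , _)
theorem4 {suc n} G T (distances , s , r , s-r-far) =
  -- `δ x y` is the distance from `y` to `x`, hence the swapped arguments of `distances`.
  let a , b , a~b , side = centralEdge G acyclic dist (λ x y → proj₂ (proj₂ (distances y x)))
                             (TreeDistance.δ-unique G acyclic dist s-r-far)
  in centralEdge⇒oddGraceful G acyclic dist a~b side
  where
  acyclic : ∀ {x} (p : Walk G x x) → ¬ IsCycle G p
  acyclic = IsTree.acyclic T
  dist : ∀ x y → ∃[ d ] IsDistance G x y d
  dist x y = proj₁ (distances x y) , proj₁ (proj₂ (distances x y))
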